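{- As $n\to\infty$, $\nu(n)=o(p(n))$; that is, $\lim_{n\to\infty}\nu(n)/p(n)=0$.
   Context: $p(n)$ is the number of integer partitions of $n$. A nuclear partition is an integer partition with no part equal to $1$, and $\nu(n)$ is the number of nuclear partitions of $n$. -}

module Defs where

open import Data.Nat
  using (ℕ; zero; suc; _≤_; _<_; _≥_; _≥?_; _>?_; z≤n; s≤s; NonZero; >-nonZero)
open import Data.Nat.Properties
  using (_≟_; ≤-refl; ≤-trans; m≤m+n; m≤n+m; +-mono-≤)
open import Data.Rational as ℚ using (ℚ; 0ℚ; ∣_∣)
open import Data.List using (List; []; _∷_; length; filter; upTo; replicate; cartesianProductWith)
open import Data.Nat.ListAction using (sum)
open import Data.List.Properties using (∷-injective)
open import Data.List.Relation.Unary.All as All using (All; []; _∷_; all?)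
open import Data.List.Relation.Unary.Any using (here; there)
open import Data.List.Relation.Unary.Linked using (Linked; []; [-]; _∷_; linked?)
open import Data.List.Relation.Unary.Unique.Propositional using (Unique; []; _∷_)
open import Data.List.Relation.Unary.Unique.Propositional.Properties
  using (upTo⁺; filter⁺; cartesianProductWith⁺)
open import Data.List.Membership.Propositional using (_∈_; _∉_)
open import Data.List.Membership.Propositional.Properties
  using (∈-upTo⁺; ∈-filter⁺; ∈-filter⁻; ∈-cartesianProductWith⁺; ∈-cartesianProductWith⁻; ∈-length)
open import Data.List.Membership.DecPropositional _≟_ using (_∉?_)
open import Data.Empty using (⊥)
open import Data.Product using (_×_; _,_; ∃-syntax; proj₂)
open import Function.Bundles using (_⇔_; mk⇔; module Equivalence)
open import Relation.Binary.PropositionalEquality using (_≡_; refl; cong)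
open import Relation.Nullary using (Dec; map′; _×-dec_)

record IsPartition (n : ℕ) (parts : List ℕ) : Set where
  constructor isPartition
  field
    decreasing : Linked _≥_ parts
    positive   : All (0 <_) parts
    total      : sum parts ≡ n

isPartition? : ∀ n parts → Dec (IsPartition n parts)
isPartition? n parts =
  map′ (λ (d , z , t) → isPartition d z t)
       (λ (isPartition d z t) → d , z , t)
       (linked? _≥?_ parts ×-dec all? (_>? 0) parts ×-dec sum parts ≟ n)

-- All lists of length at most k with entries at most m.
lists : (m k : ℕ) → List (List ℕ)
lists m zero    = [] ∷ []
lists m (suc k) = [] ∷ cartesianProductWith _∷_ (upTo (suc m)) (lists m k)

-- A partition of n has at most n parts, each at most n, so nothing is missed
-- by searching lists n n; see ∈-partitions and partitions-unique.
partitions : ℕ → List (List ℕ)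
partitions n = filter (isPartition? n) (lists n n)

nuclearPartitions : ℕ → List (List ℕ)
nuclearPartitions n = filter (1 ∉?_) (partitions n)

p : ℕ → ℕ
p n = length (partitions n)

ν : ℕ → ℕ
ν n = length (nuclearPartitions n)

-- Testing against rational ε is equivalent to testing against real ε.
_⟶_ : (ℕ → ℚ) → ℚ → Set
f ⟶ L = ∀ (ε : ℚ) → 0ℚ ℚ.< ε → ∃[ N ] (∀ n → n ≥ N → ∣ f n ℚ.- L ∣ ℚ.< ε)

infix 4 _⟶_

∈-lists : ∀ {m} k xs → All (_≤ m) xs → length xs ≤ k → xs ∈ lists m k
∈-lists zero    []       _          _       = here refl
∈-lists (suc k) []       _          _       = here refl
∈-lists (suc k) (x ∷ xs) (x≤m ∷ b) (s≤s l) =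
  there (∈-cartesianProductWith⁺ _∷_ (∈-upTo⁺ (s≤s x≤m)) (∈-lists k xs b l))

lists-unique : ∀ m k → Unique (lists m k)
lists-unique m zero    = [] ∷ []
lists-unique m (suc k) =
  All.tabulate []≢ ∷ cartesianProductWith⁺ _∷_ ∷-injective (upTo⁺ (suc m)) (lists-unique m k)
  where
  []≢ : ∀ {ys} → ys ∈ cartesianProductWith _∷_ (upTo (suc m)) (lists m k) → [] ≡ ys → ⊥
  []≢ ys∈ refl with ∈-cartesianProductWith⁻ _∷_ (upTo (suc m)) (lists m k) ys∈
  ... | _ , _ , _ , _ , ()

part≤sum : ∀ xs → All (_≤ sum xs) xs
part≤sum []       = []
part≤sum (x ∷ xs) =
  m≤m+n x (sum xs) ∷ All.map (λ y≤ → ≤-trans y≤ (m≤n+m (sum xs) x)) (part≤sum xs)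

length≤sum : ∀ {xs} → All (0 <_) xs → length xs ≤ sum xs
length≤sum []       = z≤n
length≤sum (z ∷ zs) = +-mono-≤ z (length≤sum zs)

∈-partitions : ∀ {n xs} → xs ∈ partitions n ⇔ IsPartition n xs
∈-partitions {n} {xs} = mk⇔ (λ xs∈ → proj₂ (∈-filter⁻ (isPartition? n) {xs = lists n n} xs∈)) complete
  where
  complete : IsPartition n xs → xs ∈ partitions n
  complete π@(isPartition _ pos refl) =
    ∈-filter⁺ (isPartition? n) (∈-lists n xs (part≤sum xs) (length≤sum pos)) π

partitions-unique : ∀ n → Unique (partitions n)
partitions-unique n = filter⁺ (isPartition? n) (lists-unique n n)

∈-nuclearPartitions : ∀ {n xs} → xs ∈ nuclearPartitions n ⇔ (IsPartition n xs × 1 ∉ xs)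
∈-nuclearPartitions {n} {xs} = mk⇔ sound complete
  where
  open Equivalence (∈-partitions {n} {xs})
  sound : xs ∈ nuclearPartitions n → IsPartition n xs × 1 ∉ xs
  sound xs∈ with ∈-filter⁻ (1 ∉?_) {xs = partitions n} xs∈
  ... | xs∈p , 1∉xs = to xs∈p , 1∉xs
  complete : IsPartition n xs × 1 ∉ xs → xs ∈ nuclearPartitions n
  complete (π , 1∉xs) = ∈-filter⁺ (1 ∉?_) (from π) 1∉xs

nuclearPartitions-unique : ∀ n → Unique (nuclearPartitions n)
nuclearPartitions-unique n = filter⁺ (1 ∉?_) (partitions-unique n)

ones-isPartition : ∀ n → IsPartition n (replicate n 1)
ones-isPartition n = isPartition (decreasing n) (positive n) (total n)
  where
  decreasing : ∀ n → Linked _≥_ (replicate n 1)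
  decreasing zero          = []
  decreasing (suc zero)    = [-]
  decreasing (suc (suc n)) = ≤-refl ∷ decreasing (suc n)
  positive : ∀ n → All (0 <_) (replicate n 1)
  positive zero    = []
  positive (suc n) = ≤-refl ∷ positive n
  total : ∀ n → sum (replicate n 1) ≡ n
  total zero    = refl
  total (suc n) = cong suc (total n)

p-nonZero : ∀ n → NonZero (p n)
p-nonZero n =
  >-nonZero (∈-length (Equivalence.from ∈-partitions (ones-isPartition n)))

{-# OPTIONS --safe #-}

-- Let d(π) be the number of distinct part sizes of π.  Replacing one part k of a
-- nuclear partition of n by k ones is injective in the pair (partition, k), because
-- k is the number of ones in the result; so d sums to at most p(n) over the nuclear
-- partitions of n, and at most p(n)/K of them have d ≥ K.  The others are
-- determined by fewer than K pairs (size, multiplicity), so they number at most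
-- (n+2)^(2K).  But p outgrows every polynomial: choosing the multiplicities of
-- 2, …, m+1 freely in 0, …, q and padding with ones gives p(n) ≥ (q+1)^m,
-- with q of order n for fixed m.
module Submission where

open import Defs
open import Data.Integer as ℤ using (+_)
import Data.Integer.Properties as ℤ
open import Data.Rational as ℚ using (mkℚ; 0ℚ; _/_)
import Data.Rational.Properties as ℚ
import Data.Rational.Unnormalised as ℚᵘ
import Data.Rational.Unnormalised.Properties as ℚᵘ
open import Data.Nat hiding (_/_)
open import Data.Nat.DivMod as ℕ using (m≡m%n+[m/n]*n; m%n<n; m/n*n≤m; /-monoˡ-≤; m*n/n≡m)
open import Data.Nat.Properties
open import Algebra.Properties.CommutativeSemigroup +-commutativeSemigroup using (x∙yz≈y∙xz)
open import Algebra.Properties.CommutativeSemigroup *-commutativeSemigroup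
  using (xy∙z≈xz∙y) renaming (interchange to *-interchange)
open import Data.Nat.ListAction using (sum)
open import Data.Nat.ListAction.Properties using (sum-++; sum-↭)
open import Data.Fin using (zero; suc)
open import Data.Fin.Properties using (injective⇒≤)
open import Data.List hiding (sum)
open import Data.List.Properties
  using (filter-accept; filter-reject; length-map; length-++; length-upTo; length-replicate;
         ∷-injective; ∷-injectiveˡ; ∷-injectiveʳ)
open import Data.List.Membership.Propositional using (_∈_; _∉_)
open import Data.List.Membership.Propositional.Properties
open import Data.List.Relation.Binary.Permutation.Propositional
  using (_↭_; ↭-refl; ↭-sym; ↭-trans; prep; swap; ↭⇒↭ₛ)
open import Data.List.Relation.Binary.Pointwise using (Pointwise-≡⇒≡)
open import Data.List.Relation.Unary.All as All using (All; []; _∷_)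
import Data.List.Relation.Unary.All.Properties as All
open import Data.List.Relation.Unary.AllPairs as AllPairs using (AllPairs; []; _∷_)
import Data.List.Relation.Unary.AllPairs.Properties as AllPairs
open import Data.List.Relation.Unary.Any using (here; there; index)
open import Data.List.Relation.Unary.Any.Properties using (lookup-index)
open import Data.List.Relation.Unary.Linked.Properties using (AllPairs⇒Linked; Linked⇒AllPairs)
open import Data.List.Relation.Unary.Sorted.TotalOrder.Properties using (↗↭↗⇒≋)
open import Data.List.Relation.Unary.Unique.Propositional using (Unique)
import Data.List.Relation.Unary.Unique.Propositional.Properties as Unique
open import Data.Product using (_×_; _,_; proj₁; proj₂; ∃-syntax)
open import Data.Product.Properties using (,-injectiveʳ)
open import Data.Sum using (inj₁; inj₂)
open import Function using (_∘_; flip; Equivalence)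
open import Level using (Level)
import Relation.Binary.Construct.Flip.EqAndOrd as Flip
open import Relation.Binary.PropositionalEquality
open import Relation.Nullary using (Dec; yes; no; contradiction)

private
  variable
    a b : Level
    A : Set a
    B : Set b
    k l n x : ℕ
    xs ys cs : List ℕ

-- Counting by injections

lookup-injective : {xs : List A} → Unique xs → ∀ {i j} → lookup xs i ≡ lookup xs j → i ≡ j
lookup-injective (x≢ ∷ u) {zero}  {zero}  eq = refl
lookup-injective (x≢ ∷ u) {zero}  {suc j} eq = contradiction eq (All.lookup x≢ (∈-lookup j))
lookup-injective (x≢ ∷ u) {suc i} {zero}  eq = contradiction (sym eq) (All.lookup x≢ (∈-lookup i))
lookup-injective (x≢ ∷ u) {suc i} {suc j} eq = cong suc (lookup-injective u eq)

-- Positions in `xs` inject into positions in `ys`. Injectivity is asked only on members of `xs`,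
-- because `trade` and `withOnes` are injective only under restrictions.
injective⇒length≤ : {xs : List A} {ys : List B} (f : A → B) → Unique xs →
                    (∀ {x} → x ∈ xs → f x ∈ ys) →
                    (∀ {x y} → x ∈ xs → y ∈ xs → f x ≡ f y → x ≡ y) →
                    length xs ≤ length ys
injective⇒length≤ {xs = xs} {ys} f u f∈ inj = injective⇒≤ {f = λ i → index (fx∈ i)} λ {i} {j} eq →
  lookup-injective u (inj (∈-lookup i) (∈-lookup j)
    (trans (lookup-index (fx∈ i)) (trans (cong (lookup ys) eq) (sym (lookup-index (fx∈ j))))))
  where
  fx∈ : ∀ i → f (lookup xs i) ∈ ys
  fx∈ i = f∈ (∈-lookup i)

length-cartesianProductWith : ∀ {c} {C : Set c} (f : A → B → C) xs ys →
  length (cartesianProductWith f xs ys) ≡ length xs * length ys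
length-cartesianProductWith f []       ys = refl
length-cartesianProductWith f (x ∷ xs) ys =
  trans (length-++ (map (f x) ys))
        (cong₂ _+_ (length-map (f x) ys) (length-cartesianProductWith f xs ys))

length-lists : ∀ m k → length (lists m k) ≤ (2 + m) ^ k
length-lists m zero    = ≤-refl
length-lists m (suc k) = begin
  suc (length (cartesianProductWith _∷_ (upTo (suc m)) (lists m k)))
    ≡⟨ cong suc (length-cartesianProductWith _∷_ (upTo (suc m)) (lists m k)) ⟩
  suc (length (upTo (suc m)) * length (lists m k))
    ≡⟨ cong (λ u → suc (u * length (lists m k))) (length-upTo (suc m)) ⟩
  suc (suc m * length (lists m k))
    -- The extra empty list at each level is paid for by the base 2 + m in place of 1 + m.
    ≤⟨ +-mono-≤ (m^n>0 (2 + m) k) (*-monoʳ-≤ (suc m) (length-lists m k)) ⟩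
  (2 + m) ^ suc k ∎
  where open ≤-Reasoning

-- Decreasing lists

AllPairs-replicate : ∀ c x → AllPairs _≥_ (replicate c x)
AllPairs-replicate zero    x = []
AllPairs-replicate (suc c) x = All.replicate⁺ c ≤-refl ∷ AllPairs-replicate c x

-- Decreasing means sorted for the flipped order, and the sorted arrangement of a multiset is
-- unique.
decreasing-↭⇒≡ : AllPairs _≥_ xs → AllPairs _≥_ ys → xs ↭ ys → xs ≡ ys
decreasing-↭⇒≡ dx dy π = Pointwise-≡⇒≡
  (↗↭↗⇒≋ (Flip.totalOrder ≤-totalOrder) (AllPairs⇒Linked dx) (AllPairs⇒Linked dy) (↭⇒↭ₛ π))

delete : ℕ → List ℕ → List ℕ
delete k [] = []
delete k (x ∷ xs) with k ≟ x
... | yes _ = xs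
... | no  _ = x ∷ delete k xs

↭-delete : k ∈ xs → xs ↭ k ∷ delete k xs
↭-delete {k} {x ∷ xs} k∈ with k ≟ x
↭-delete k∈ | yes refl = ↭-refl
↭-delete (here k≡x) | no k≢x = contradiction k≡x k≢x
↭-delete {k} {x ∷ xs} (there k∈) | no _ = ↭-trans (prep x (↭-delete k∈)) (swap x k ↭-refl)

All-delete : ∀ {p} {P : ℕ → Set p} k → All P xs → All P (delete k xs)
All-delete k [] = []
All-delete {x ∷ xs} k (px ∷ pxs) with k ≟ x
... | yes _ = pxs
... | no  _ = px ∷ All-delete k pxs

AllPairs-delete : ∀ {r} {R : ℕ → ℕ → Set r} k → AllPairs R xs → AllPairs R (delete k xs)
AllPairs-delete k [] = []
AllPairs-delete {x ∷ xs} k (px ∷ pxs) with k ≟ x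
... | yes _ = pxs
... | no  _ = All-delete k px ∷ AllPairs-delete k pxs

-- Reinserting `k` recovers the multiset of either list, which determines a decreasing list.
delete-injective : AllPairs _≥_ xs → AllPairs _≥_ ys → k ∈ xs → k ∈ ys →
                   delete k xs ≡ delete k ys → xs ≡ ys
delete-injective {k = k} dx dy k∈xs k∈ys eq = decreasing-↭⇒≡ dx dy
  (↭-trans (↭-delete k∈xs) (subst (λ zs → k ∷ zs ↭ _) (sym eq) (↭-sym (↭-delete k∈ys))))

-- Run lengths

prepend : ℕ → List (ℕ × ℕ) → List (ℕ × ℕ)
prepend x [] = (x , 1) ∷ []
prepend x ((y , c) ∷ r) with x ≟ y
... | yes _ = (y , suc c) ∷ r
... | no  _ = (x , 1) ∷ (y , c) ∷ r

runs : List ℕ → List (ℕ × ℕ)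
runs = foldr prepend []

-- On a decreasing list equal parts are adjacent, so each size has a single run and the length is
-- the number d of distinct sizes.
sizes : List ℕ → List ℕ
sizes xs = map proj₁ (runs xs)

-- Flattened, the codes lie in Defs.lists, which also bounds their number.
flatten : List (ℕ × ℕ) → List ℕ
flatten [] = []
flatten ((x , c) ∷ r) = x ∷ c ∷ flatten r

expand : List ℕ → List ℕ
expand (x ∷ c ∷ r) = replicate c x ++ expand r
expand _           = []

expand-prepend : ∀ x r → expand (flatten (prepend x r)) ≡ x ∷ expand (flatten r)
expand-prepend x [] = refl
expand-prepend x ((y , c) ∷ r) with x ≟ y
... | yes refl = refl
... | no  _    = refl

-- A left inverse of the encoding, which makes the codes in `fewSizes≤` distinct.
expand-runs : ∀ xs → expand (flatten (runs xs)) ≡ xs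
expand-runs []       = refl
expand-runs (x ∷ xs) = trans (expand-prepend x (runs xs)) (cong (x ∷_) (expand-runs xs))

length-flatten : ∀ r → length (flatten r) ≡ length r * 2
length-flatten []      = refl
length-flatten (_ ∷ r) = cong 2+ (length-flatten r)

All-flatten : ∀ {p} {P : ℕ → Set p} {r} → All (λ (x , c) → P x × P c) r → All P (flatten r)
All-flatten []               = []
All-flatten ((px , pc) ∷ ps) = px ∷ pc ∷ All-flatten ps

-- For a partition of n this bounds both components by n. The membership also feeds the comparison
-- in `sizes-decreasing`.
runs-bounded : ∀ xs → All (λ (x , c) → x ∈ xs × c ≤ length xs) (runs xs)
runs-bounded [] = []
runs-bounded (x ∷ xs) with runs xs | runs-bounded xs
... | [] | _ = (here refl , s≤s z≤n) ∷ []
... | (y , c) ∷ r | (y∈ , c≤) ∷ bs with x ≟ y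
...   | yes _ = (there y∈ , s≤s c≤) ∷ All.map (λ (z∈ , d≤) → there z∈ , m≤n⇒m≤1+n d≤) bs
...   | no  _ = (here refl , s≤s z≤n) ∷
                All.map (λ (z∈ , d≤) → there z∈ , m≤n⇒m≤1+n d≤) ((y∈ , c≤) ∷ bs)

sizes⊆ : x ∈ sizes xs → x ∈ xs
sizes⊆ {xs = xs} = All.lookup (All.map⁺ (All.map proj₁ (runs-bounded xs)))

-- A new run opens only when the new entry differs from the head size; standing in front of it in a
-- decreasing list, the entry is then strictly larger.
sizes-decreasing : AllPairs _≥_ xs → AllPairs _>_ (sizes xs)
sizes-decreasing [] = []
sizes-decreasing {x ∷ xs} (x≥ ∷ dxs) with runs xs | runs-bounded xs | sizes-decreasing dxs
... | [] | _ | _ = [] ∷ []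
... | (y , c) ∷ r | (y∈ , _) ∷ _ | y> ∷ dr with x ≟ y
...   | yes _   = y> ∷ dr
...   | no x≢y = (y<x ∷ All.map (λ z<y → <-trans z<y y<x) y>) ∷ y> ∷ dr
  where
  y<x : y < x
  y<x = ≤∧≢⇒< (All.lookup x≥ y∈) (x≢y ∘ sym)

-- Trading a part for ones

-- The length is the sum of d(π); a list of pairs rather than a number, so that `trade` can be an
-- injection out of it.
withSizes : List (List ℕ) → List (List ℕ × ℕ)
withSizes = concatMap (λ xs → map (xs ,_) (sizes xs))

∈-withSizes⁻ : ∀ xss {v} → v ∈ withSizes xss → proj₁ v ∈ xss × proj₂ v ∈ sizes (proj₁ v)
∈-withSizes⁻ (xs ∷ xss) v∈ with ∈-++⁻ (map (xs ,_) (sizes xs)) v∈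
... | inj₂ v∈xss = let xs∈ , k∈ = ∈-withSizes⁻ xss v∈xss in there xs∈ , k∈
... | inj₁ v∈xs with ∈-map⁻ (xs ,_) v∈xs
...   | _ , k∈ , refl = here refl , k∈

withSizes-unique : ∀ {xss} → Unique xss → All (AllPairs _≥_) xss → Unique (withSizes xss)
withSizes-unique [] [] = []
withSizes-unique {xs ∷ xss} (xs≢ ∷ u) (dxs ∷ ds) =
  Unique.++⁺ (Unique.map⁺ ,-injectiveʳ (AllPairs.map >⇒≢ (sizes-decreasing dxs)))
             (withSizes-unique u ds)
             λ (v∈xs , v∈xss) → disjoint (∈-map⁻ (xs ,_) v∈xs) (∈-withSizes⁻ xss v∈xss)
  where
  disjoint : ∀ {v} → ∃[ k ] (k ∈ sizes xs × v ≡ (xs , k)) →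
             proj₁ v ∈ xss × proj₂ v ∈ sizes (proj₁ v) → _
  disjoint (_ , _ , refl) (xs∈ , _) = All.lookup xs≢ xs∈ refl

fewSizes? : ∀ K (xs : List ℕ) → Dec (length (sizes xs) < K)
fewSizes? K xs = length (sizes xs) <? K

fewSizes : ℕ → List (List ℕ) → List (List ℕ)
fewSizes K = filter (fewSizes? K)

-- Markov's inequality without subtraction: an entry with at least K sizes contributes K pairs, and
-- any other is charged to the last term.
length-withSizes : ∀ K xss → K * length xss ≤ length (withSizes xss) + K * length (fewSizes K xss)
length-withSizes K [] = ≤-refl
length-withSizes K (xs ∷ xss)
  rewrite length-++ (map (xs ,_) (sizes xs)) {withSizes xss} | length-map (xs ,_) (sizes xs)
  with fewSizes? K xs
... | yes d<K = begin
  K * suc (length xss)                                       ≡⟨ *-suc K _ ⟩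
  K + K * length xss                                         ≤⟨ +-monoʳ-≤ K (length-withSizes K xss) ⟩
  K + (length (withSizes xss) + K * length (fewSizes K xss)) ≡⟨ x∙yz≈y∙xz K (length (withSizes xss)) _ ⟩
  length (withSizes xss) + (K + K * length (fewSizes K xss)) ≤⟨ +-mono-≤ (m≤n+m _ d) (≤-reflexive (sym (*-suc K _))) ⟩
  d + length (withSizes xss) + K * suc (length (fewSizes K xss))
    ≡⟨ cong (λ yss → d + length (withSizes xss) + K * length yss) (filter-accept (fewSizes? K) d<K) ⟨
  d + length (withSizes xss) + K * length (fewSizes K (xs ∷ xss)) ∎
  where
  open ≤-Reasoning
  d = length (sizes xs)
... | no d≮K = begin
  K * suc (length xss)                                       ≡⟨ *-suc K _ ⟩
  K + K * length xss                                         ≤⟨ +-mono-≤ (≮⇒≥ d≮K) (length-withSizes K xss) ⟩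
  d + (length (withSizes xss) + K * length (fewSizes K xss)) ≡⟨ +-assoc d _ _ ⟨
  d + length (withSizes xss) + K * length (fewSizes K xss)
    ≡⟨ cong (λ yss → d + length (withSizes xss) + K * length yss) (filter-reject (fewSizes? K) d≮K) ⟨
  d + length (withSizes xss) + K * length (fewSizes K (xs ∷ xss)) ∎
  where
  open ≤-Reasoning
  d = length (sizes xs)

replicate-injective : replicate k x ≡ replicate l x → k ≡ l
replicate-injective {k} {l = l} eq =
  trans (sym (length-replicate k)) (trans (cong length eq) (length-replicate l))

-- The first 1 of the common list, or else its end, marks the boundary on both sides.
++-ones-injective : 1 ∉ xs → 1 ∉ ys → xs ++ replicate k 1 ≡ ys ++ replicate l 1 → xs ≡ ys × k ≡ l
++-ones-injective {[]}     {[]}     _    _    eq = refl , replicate-injective eq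
++-ones-injective {[]}     {y ∷ ys} {k = suc k} _ 1∉ys eq =
  contradiction (here (∷-injectiveˡ eq)) 1∉ys
++-ones-injective {x ∷ xs} {[]}     {l = suc l} 1∉xs _ eq =
  contradiction (here (sym (∷-injectiveˡ eq))) 1∉xs
++-ones-injective {x ∷ xs} {y ∷ ys} 1∉xs 1∉ys eq with ∷-injective eq
... | refl , eq′ with ++-ones-injective (1∉xs ∘ there) (1∉ys ∘ there) eq′
...   | refl , k≡l = refl , k≡l

trade : List ℕ × ℕ → List ℕ
trade (xs , k) = delete k xs ++ replicate k 1

∈-delete⁻ : x ∈ delete k xs → x ∈ xs
∈-delete⁻ {k = k} {xs} = All.lookup (All-delete k (All.tabulate (λ x∈ → x∈)))

≥-trans : ∀ {i j k} → i ≥ j → j ≥ k → i ≥ k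
≥-trans = flip ≤-trans

-- The ones make up for the deleted `k`, and appending them keeps the order because all parts are
-- positive.
trade-isPartition : k ∈ xs → IsPartition n xs → IsPartition n (trade (xs , k))
trade-isPartition {k} {xs} {n} k∈ (isPartition dec pos tot) = isPartition
  (AllPairs⇒Linked (AllPairs.++⁺ (AllPairs-delete k (Linked⇒AllPairs ≥-trans dec))
                                 (AllPairs-replicate k 1)
                                 (All.map (All.replicate⁺ k) (All-delete k pos))))
  (All.++⁺ (All-delete k pos) (All.replicate⁺ k ≤-refl))
  (begin
    sum (delete k xs ++ replicate k 1)       ≡⟨ sum-++ (delete k xs) _ ⟩
    sum (delete k xs) + sum (replicate k 1)  ≡⟨ cong (λ t → sum (delete k xs) + t) (IsPartition.total (ones-isPartition k)) ⟩
    sum (delete k xs) + k                    ≡⟨ +-comm _ k ⟩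
    k + sum (delete k xs)                    ≡⟨ sum-↭ (↭-delete k∈) ⟨
    sum xs                                   ≡⟨ tot ⟩
    n                                        ∎)
  where open ≡-Reasoning

nuclear-decreasing : All (AllPairs _≥_) (nuclearPartitions n)
nuclear-decreasing {n} = All.tabulate λ xs∈ →
  Linked⇒AllPairs ≥-trans (IsPartition.decreasing (proj₁ (Equivalence.to (∈-nuclearPartitions {n}) xs∈)))

-- Nuclearity keeps `delete k xs` free of ones, so the result reveals `k` and the remainder, and
-- with them the partition.
withSizes≤p : ∀ n → length (withSizes (nuclearPartitions n)) ≤ p n
withSizes≤p n = injective⇒length≤ trade
  (withSizes-unique (nuclearPartitions-unique n) (nuclear-decreasing {n})) ∈p inj
  where
  N = nuclearPartitions n
  ∈p : ∀ {v} → v ∈ withSizes N → trade v ∈ partitions n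
  ∈p v∈ with ∈-withSizes⁻ N v∈
  ... | xs∈ , k∈ = Equivalence.from ∈-partitions
    (trade-isPartition (sizes⊆ k∈) (proj₁ (Equivalence.to (∈-nuclearPartitions {n}) xs∈)))
  inj : ∀ {v w} → v ∈ withSizes N → w ∈ withSizes N → trade v ≡ trade w → v ≡ w
  inj {xs , k} {ys , l} v∈ w∈ eq with ∈-withSizes⁻ N v∈ | ∈-withSizes⁻ N w∈
  ... | xs∈ , k∈ | ys∈ , l∈ with ++-ones-injective (1∉ xs∈) (1∉ ys∈) eq
    where
    1∉ : ∀ {zs m} → zs ∈ N → 1 ∉ delete m zs
    1∉ zs∈ = proj₂ (Equivalence.to (∈-nuclearPartitions {n}) zs∈) ∘ ∈-delete⁻
  ...   | eq′ , refl = cong (_, k) (delete-injective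
    (All.lookup (nuclear-decreasing {n}) xs∈) (All.lookup (nuclear-decreasing {n}) ys∈)
    (sizes⊆ k∈) (sizes⊆ l∈) eq′)

-- Each of the fewer than K runs takes two code entries: a part, at most the sum n, and a
-- multiplicity, at most the number of parts, which is at most n by positivity.
fewSizes≤ : ∀ K n → length (fewSizes K (nuclearPartitions n)) ≤ (2 + n) ^ (K * 2)
fewSizes≤ K n = ≤-trans
  (injective⇒length≤ (flatten ∘ runs) (Unique.filter⁺ (fewSizes? K) (nuclearPartitions-unique n)) ∈lists
    λ {xs} {ys} _ _ eq → trans (sym (expand-runs xs)) (trans (cong expand eq) (expand-runs ys)))
  (length-lists n (K * 2))
  where
  ∈lists : ∀ {xs} → xs ∈ fewSizes K (nuclearPartitions n) → flatten (runs xs) ∈ lists n (K * 2)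
  ∈lists {xs} xs∈ with ∈-filter⁻ (fewSizes? K) {xs = nuclearPartitions n} xs∈
  ... | xs∈N , d<K with Equivalence.to (∈-nuclearPartitions {n}) xs∈N
  ...   | isPartition _ pos refl , _ = ∈-lists (K * 2) _
    (All-flatten (All.map (λ (x∈ , c≤) → All.lookup (part≤sum xs) x∈ , ≤-trans c≤ (length≤sum pos))
                          (runs-bounded xs)))
    (subst (_≤ K * 2) (sym (length-flatten (runs xs)))
      (*-monoˡ-≤ 2 (subst (_≤ K) (length-map proj₁ (runs xs)) (<⇒≤ d<K))))

-- A superpolynomial lower bound for p

-- cs lists the multiplicities of 1 + length cs, …, 3, 2, in this order.
withOnes : List ℕ → ℕ → List ℕ
withOnes []       n = replicate n 1
withOnes (c ∷ cs) n = replicate c (2 + length cs) ++ withOnes cs (n ∸ c * (2 + length cs))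

-- The sum 2 + 3 + ... + (m + 1); q times it is the largest weight that multiplicities up to q can
-- use.
partsUpTo : ℕ → ℕ
partsUpTo zero    = 0
partsUpTo (suc m) = 2 + m + partsUpTo m

withOnes-bounded : ∀ cs n → All (_≤ suc (length cs)) (withOnes cs n)
withOnes-bounded []       n = All.replicate⁺ n ≤-refl
withOnes-bounded (c ∷ cs) n =
  All.++⁺ (All.replicate⁺ c ≤-refl) (All.map m≤n⇒m≤1+n (withOnes-bounded cs _))

withOnes-decreasing : ∀ cs n → AllPairs _≥_ (withOnes cs n)
withOnes-decreasing []       n = AllPairs-replicate n 1
withOnes-decreasing (c ∷ cs) n = AllPairs.++⁺
  (AllPairs-replicate c _) (withOnes-decreasing cs _)
  (All.replicate⁺ c (All.map m≤n⇒m≤1+n (withOnes-bounded cs _)))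

withOnes-positive : ∀ cs n → All (0 <_) (withOnes cs n)
withOnes-positive []       n = All.replicate⁺ n ≤-refl
withOnes-positive (c ∷ cs) n = All.++⁺ (All.replicate⁺ c z<s) (withOnes-positive cs _)

sum-replicate : ∀ c x → sum (replicate c x) ≡ c * x
sum-replicate zero    x = refl
sum-replicate (suc c) x = cong (λ t → x + t) (sum-replicate c x)

-- The bound keeps every truncated subtraction in `withOnes` exact, so the ones fill just what is
-- missing.
sum-withOnes : ∀ {q cs n} → All (_≤ q) cs → q * partsUpTo (length cs) ≤ n → sum (withOnes cs n) ≡ n
sum-withOnes {n = n} [] _ = trans (sum-replicate n 1) (*-identityʳ n)
sum-withOnes {q} {c ∷ cs} {n} (c≤q ∷ cs≤q) bound = let open ≡-Reasoning in begin
  sum (replicate c s ++ withOnes cs (n ∸ c * s))     ≡⟨ sum-++ (replicate c s) _ ⟩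
  sum (replicate c s) + sum (withOnes cs (n ∸ c * s))
    ≡⟨ cong₂ _+_ (sum-replicate c s) (sum-withOnes cs≤q (m+n≤o⇒m≤o∸n (q * partsUpTo (length cs)) fits)) ⟩
  c * s + (n ∸ c * s)                                ≡⟨ m+[n∸m]≡n (m+n≤o⇒n≤o (q * partsUpTo (length cs)) fits) ⟩
  n                                                  ∎
  where
  s = 2 + length cs
  fits : q * partsUpTo (length cs) + c * s ≤ n
  fits = begin
    q * partsUpTo (length cs) + c * s  ≤⟨ +-monoʳ-≤ _ (*-monoˡ-≤ s c≤q) ⟩
    q * partsUpTo (length cs) + q * s  ≡⟨ +-comm _ (q * s) ⟩
    q * s + q * partsUpTo (length cs)  ≡⟨ *-distribˡ-+ q s _ ⟨
    q * (s + partsUpTo (length cs))    ≤⟨ bound ⟩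
    n                                  ∎
    where open ≤-Reasoning

-- Everything after the copies of `x` is smaller, so the list fixes the length of its leading block.
replicate-++-injective : ∀ c d → All (_< x) xs → All (_< x) ys →
                         replicate c x ++ xs ≡ replicate d x ++ ys → c ≡ d × xs ≡ ys
replicate-++-injective zero    zero    _ _ eq = refl , eq
replicate-++-injective zero    (suc d) (x< ∷ _) _ refl = contradiction x< (<-irrefl refl)
replicate-++-injective (suc c) zero    _ (x< ∷ _) refl = contradiction x< (<-irrefl refl)
replicate-++-injective (suc c) (suc d) xs< ys< eq
  with replicate-++-injective c d xs< ys< (∷-injectiveʳ eq)
... | refl , eq′ = refl , eq′

-- Equal lengths give both sides the same leading size; multiplicities are then read off from the
-- largest size down, with equal remainders of `n`.
withOnes-injective : ∀ cs ds n → length cs ≡ length ds → withOnes cs n ≡ withOnes ds n → cs ≡ ds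
withOnes-injective []       []       n _  _  = refl
withOnes-injective (c ∷ cs) (d ∷ ds) n ls eq
  rewrite suc-injective ls
  with replicate-++-injective c d
    (subst (λ l → All (_< 2 + l) (withOnes cs (n ∸ c * (2 + length ds)))) (suc-injective ls)
       (All.map s≤s (withOnes-bounded cs _)))
    (All.map s≤s (withOnes-bounded ds _)) eq
... | refl , eq′ = cong (c ∷_) (withOnes-injective cs ds _ (suc-injective ls) eq′)

-- Lengths are fixed, unlike in `lists`: a leading multiplicity 0 changes nothing in `withOnes`, so
-- shorter lists would give repetitions.
tuples : ℕ → ℕ → List (List ℕ)
tuples q zero    = [] ∷ []
tuples q (suc m) = cartesianProductWith _∷_ (upTo (suc q)) (tuples q m)

length-tuples : ∀ q m → length (tuples q m) ≡ suc q ^ m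
length-tuples q zero    = refl
length-tuples q (suc m) = trans
  (length-cartesianProductWith _∷_ (upTo (suc q)) (tuples q m))
  (cong₂ _*_ (length-upTo (suc q)) (length-tuples q m))

tuples-unique : ∀ q m → Unique (tuples q m)
tuples-unique q zero    = [] ∷ []
tuples-unique q (suc m) =
  Unique.cartesianProductWith⁺ _∷_ ∷-injective (Unique.upTo⁺ (suc q)) (tuples-unique q m)

∈-tuples⁻ : ∀ q m → cs ∈ tuples q m → length cs ≡ m × All (_≤ q) cs
∈-tuples⁻ q zero (here refl) = refl , []
∈-tuples⁻ q (suc m) cs∈ with ∈-cartesianProductWith⁻ _∷_ (upTo (suc q)) (tuples q m) cs∈
... | _ , _ , c∈ , cs∈′ , refl with ∈-tuples⁻ q m cs∈′
...   | refl , cs≤q = refl , ≤-pred (∈-upTo⁻ c∈) ∷ cs≤q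

power≤p : ∀ q m n → q * partsUpTo m ≤ n → suc q ^ m ≤ p n
power≤p q m n bound = subst (_≤ p n) (length-tuples q m)
  (injective⇒length≤ (λ cs → withOnes cs n) (tuples-unique q m) ∈p inj)
  where
  ∈p : ∀ {cs} → cs ∈ tuples q m → withOnes cs n ∈ partitions n
  ∈p {cs} cs∈ with ∈-tuples⁻ q m cs∈
  ... | refl , cs≤q = Equivalence.from ∈-partitions
    (isPartition (AllPairs⇒Linked (withOnes-decreasing cs n)) (withOnes-positive cs n)
                 (sum-withOnes cs≤q bound))
  inj : ∀ {cs ds} → cs ∈ tuples q m → ds ∈ tuples q m → withOnes cs n ≡ withOnes ds n → cs ≡ ds
  inj {cs} {ds} cs∈ ds∈ = withOnes-injective cs ds n
    (trans (proj₁ (∈-tuples⁻ q m cs∈)) (sym (proj₁ (∈-tuples⁻ q m ds∈))))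

^-distribʳ-* : ∀ m n k → (m * n) ^ k ≡ m ^ k * n ^ k
^-distribʳ-* m n zero    = refl
^-distribʳ-* m n (suc k) =
  trans (cong (m * n *_) (^-distribʳ-* m n k)) (*-interchange m n (m ^ k) (n ^ k))

-- With r + 1 free multiplicities `power≤p` gives degree r + 1 in q, and the spare factor outgrows
-- every constant.
p-superpolynomial : ∀ K r → ∃[ n₀ ] (∀ n → n ≥ n₀ → K * (2 + n) ^ r ≤ p n)
-- This threshold forces q ≥ C.
p-superpolynomial K r = C * suc W , bound
  where
  open ≤-Reasoning
  W = partsUpTo (suc r)
  -- Collects the constants left by 2 + n ≤ (2 + W)(1 + q).
  C = K * (2 + W) ^ r
  bound : ∀ n → n ≥ C * suc W → K * (2 + n) ^ r ≤ p n
  bound n n≥ = begin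
    K * (2 + n) ^ r                     ≤⟨ *-monoʳ-≤ K (^-monoˡ-≤ r 2+n≤) ⟩
    K * ((2 + W) * suc q) ^ r           ≡⟨ cong (K *_) (^-distribʳ-* (2 + W) (suc q) r) ⟩
    K * ((2 + W) ^ r * suc q ^ r)       ≡⟨ *-assoc K _ _ ⟨
    C * suc q ^ r                       ≤⟨ *-monoˡ-≤ (suc q ^ r) (m≤n⇒m≤1+n C≤q) ⟩
    suc q ^ suc r                       ≤⟨ power≤p q (suc r) n
                                             (≤-trans (*-monoʳ-≤ q (n≤1+n W)) (m/n*n≤m n (suc W))) ⟩
    p n                                 ∎
    where
    -- The divisor 1 + W is visibly nonzero, and qW ≤ n still holds.
    q = n ℕ./ suc W
    C≤q : C ≤ q
    C≤q = subst (_≤ q) (m*n/n≡m C (suc W)) (/-monoˡ-≤ (suc W) n≥)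
    2+n≤ : 2 + n ≤ (2 + W) * suc q
    2+n≤ = begin
      2 + n                            ≡⟨ cong 2+ (m≡m%n+[m/n]*n n (suc W)) ⟩
      2 + (n ℕ.% suc W + q * suc W)    ≤⟨ s≤s (+-monoˡ-≤ (q * suc W) (m%n<n n (suc W))) ⟩
      1 + suc q * suc W                ≤⟨ +-monoˡ-≤ (suc q * suc W) (s≤s z≤n) ⟩
      suc q + suc q * suc W            ≡⟨ *-suc (suc q) (suc W) ⟨
      suc q * (2 + W)                  ≡⟨ *-comm (suc q) (2 + W) ⟩
      (2 + W) * suc q                  ∎

-- Combining the two bounds

m*2≡m+m : ∀ m → m * 2 ≡ m + m
m*2≡m+m m = trans (*-comm m 2) (cong (λ t → m + t) (+-identityʳ m))

ν-negligible : ∀ K → ∃[ n₀ ] (∀ n → n ≥ n₀ → K * ν n ≤ p n)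
-- At threshold 2K, the traded pairs and the partitions with few sizes each account for at most p(n)
-- of 2K ν(n), hence the doubling. The last factor 2 in the exponent is the code length of a run.
ν-negligible K with p-superpolynomial (K * 2) (K * 2 * 2)
... | n₀ , bound = n₀ , λ n n≥ → *-cancelʳ-≤ (K * ν n) (p n) 2 (begin
  K * ν n * 2                                         ≡⟨ xy∙z≈xz∙y K (ν n) 2 ⟩
  K * 2 * ν n                                         ≤⟨ length-withSizes (K * 2) (nuclearPartitions n) ⟩
  length (withSizes (nuclearPartitions n)) + K * 2 * length (fewSizes (K * 2) (nuclearPartitions n))
    ≤⟨ +-mono-≤ (withSizes≤p n) (*-monoʳ-≤ (K * 2) (fewSizes≤ (K * 2) n)) ⟩
  p n + K * 2 * (2 + n) ^ (K * 2 * 2)                 ≤⟨ +-monoʳ-≤ (p n) (bound n n≥) ⟩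
  p n + p n                                           ≡⟨ m*2≡m+m (p n) ⟨
  p n * 2                                             ∎)
  where open ≤-Reasoning

-- From natural-number bounds to the rational limit

∣i/d∣<ε : ∀ i d .{{_ : NonZero d}} ε → 0ℚ ℚ.< ε → ℚ.↧ₙ ε * i < d → ℚ.∣ (+ i) / d ℚ.- 0ℚ ∣ ℚ.< ε
∣i/d∣<ε i d@(suc d-1) ε@(mkℚ (+ suc e) b-1 _) 0<ε b*i<d =
  subst (ℚ._< ε) (sym (trans (cong ℚ.∣_∣ (ℚ.+-identityʳ ((+ i) / d))) (ℚ.0≤p⇒∣p∣≡p i/d≥0)))
    -- Cross-multiplication takes place among unnormalised rationals, where i/d keeps its unreduced
    -- form.
    (ℚ.toℚᵘ-cancel-< (ℚᵘ.<-respˡ-≃ (ℚᵘ.≃-sym (ℚ.toℚᵘ-fromℚᵘ (ℚᵘ.mkℚᵘ (+ i) d-1)))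
      (ℚᵘ.*<* (subst₂ ℤ._<_ (ℤ.pos-* i (suc b-1)) (ℤ.pos-* (suc e) d) (ℤ.+<+ i*b<)))))
  where
  i/d≥0 : 0ℚ ℚ.≤ (+ i) / d
  i/d≥0 = ℚ.nonNegative⁻¹ _ {{ℚ.normalize-nonNeg i d}}
  i*b< : i * suc b-1 < suc e * d
  -- The numerator 1 + e of ε is at least 1, so d ≤ (1 + e)d.
  i*b< = <-≤-trans (subst (_< d) (*-comm (suc b-1) i) b*i<d) (m≤m+n d (e * d))
∣i/d∣<ε i d (mkℚ (+ 0)     _ _) (ℚ.*<* (ℤ.+<+ ())) _
∣i/d∣<ε i d (mkℚ ℤ.-[1+ _ ] _ _) (ℚ.*<* ()) _

-- For i > 0 the extra copy of i gives strictness; for i = 0 the positivity of d does.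
1+m*i≤d⇒m*i<d : ∀ m i d → 0 < d → suc m * i ≤ d → m * i < d
1+m*i≤d⇒m*i<d m zero    d 0<d _ = subst (_< d) (sym (*-zeroʳ m)) 0<d
1+m*i≤d⇒m*i<d m (suc i) d _   h = ≤-trans (s≤s (m≤n+m (m * suc i) i)) h

mainTheorem2 : (λ n → _/_ (+ ν n) (p n) {{p-nonZero n}}) ⟶ 0ℚ
mainTheorem2 ε 0<ε = proj₁ bound , λ n n≥ → ∣i/d∣<ε (ν n) (p n) {{p-nonZero n}} ε 0<ε
  (1+m*i≤d⇒m*i<d (ℚ.↧ₙ ε) (ν n) (p n) (>-nonZero⁻¹ (p n) {{p-nonZero n}}) (proj₂ bound n n≥))
  where
  bound : ∃[ n₀ ] (∀ n → n ≥ n₀ → suc (ℚ.↧ₙ ε) * ν n ≤ p n)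
  -- One more than the denominator of ε, to leave the spare copy of ν(n) from which strictness is
  -- drawn.
  bound = ν-negligible (suc (ℚ.↧ₙ ε))
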